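{- Let $n$ be a positive even integer, and let $a_1,\ldots,a_n\in\mathbb{Z}$ with $\sum_{k=1}^n a_k\equiv 0 \pmod n$. Then there exists a permutation $\sigma$ of $\{1,\ldots,n\}$ such that $$\sum_{k=1}^n k\,a_{\sigma(k)}\equiv 0 \pmod{n/2}.$$ Consequently, if $w_1,\ldots,w_n\in\mathbb{Z}$ form an arithmetic progression with even common difference, then there exists a permutation $\sigma$ of $\{1,\ldots,n\}$ such that $\sum_{k=1}^n w_k a_{\sigma(k)}\equiv 0 \pmod n$. -}

module Defs where

open import Data.Nat using (ℕ; zero; suc)
open import Data.Fin using (Fin; zero; suc)
open import Data.Integer using (ℤ; _+_; +_)

∑ : ∀ {n} → (Fin n → ℤ) → ℤ
∑ {zero}  f = + 0
∑ {suc n} f = f zero + ∑ (λ k → f (suc k))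

{-# OPTIONS --safe #-}

-- Modulo m = n / 2 the weights 1, …, n are 0, …, m - 1, each used twice, so it is enough to arrange
-- 2m integers in m pairs such that the sum of k (x_k + y_k) over k < m is ≡ 0 modulo m; for the weights
-- w the total being ≡ 0 modulo n disposes of the constant term.  The arrangement exists by induction
-- on m = p q, p prime.
-- If all the integers are ≡ c modulo p, replace each a by (a - c) / p and apply the case q to p rows
-- of 2q integers.  Otherwise fill p rows (row i with the weights i q, …, i q + q - 1) using the case q,
-- the first row being chosen so that some residue modulo p occurs in it an odd number of times.  Then
-- some weight j of the first row carries two integers that differ modulo p, and rearranging only the
-- column of weights i q + j changes the sum by a multiple of q, which can be prescribed modulo p q.
-- That last claim is the case of a prime p with the stronger conclusion that 2p integers, not all
-- equal modulo p, attain every residue.  Either they form p pairs that are unequal modulo p, and then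
-- exchanging the entries of pairs that straddle consecutive weights reaches every residue as in
-- Cauchy–Davenport; or p of them are equal to some v modulo p, and then sliding an x ≢ v through
-- copies of v does.

module Submission where

open import Defs
open import Data.Bool using (Bool; true; false; _xor_)
open import Data.Bool.Properties using (xor-assoc; xor-comm; xor-same)
open import Data.Fin using (Fin; zero; suc; toℕ; fromℕ<; cast)
open import Data.Fin.Permutation using (Permutation′; _⟨$⟩ʳ_; cast-id; _∘ₚ_)
open import Data.Fin.Properties using (toℕ-fromℕ<; toℕ-injective; toℕ<n; any?; cast-involutive)
open import Data.Fin.Subset using (Subset; _∈_; _∉_; ⁅_⁆; _∪_; ∣_∣; ⊤; Nonempty)
open import Data.Fin.Subset.Properties
  using (_∈?_; x∈⁅x⁆; x∈⁅y⁆⇒x≡y; x∈p∪q⁻; x∈p∪q⁺; q⊆p∪q; p⊂q⇒∣p∣<∣q∣; ∣p∣≤n; ∣⁅x⁆∣≡1; ⊆-antisym; ⊆⊤; ∈⊤)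
open import Data.Integer using (ℤ; +_; -[1+_]; _+_; _*_; -_; _-_; 0ℤ; 1ℤ)
open import Data.Integer.DivMod using (_%ℕ_; _/ℕ_; n%ℕd<d; a≡a%ℕn+[a/ℕn]*n)
open import Data.Integer.Divisibility using (_∣_)
import Data.Integer.Divisibility.Signed as Signed
open import Data.Integer.Properties
  using (+-identityˡ; +-identityʳ; +-assoc; +-0-isCommutativeMonoid; +-injective; pos-+; pos-*)
open import Data.Integer.Tactic.RingSolver using (solve-∀)
open import Data.List using (List; []; _∷_; [_]; _++_; length; map; concat; foldr; tabulate; lookup)
open import Data.List.Membership.Propositional as Membership using (find)
open import Data.List.Membership.Propositional.Properties using (∈-∃++)
open import Data.List.Properties using (++-assoc; length-++; length-map; length-tabulate; lookup-tabulate)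
open import Data.List.Relation.Binary.Permutation.Homogeneous using (onIndices)
open import Data.List.Relation.Binary.Permutation.Propositional
open import Data.List.Relation.Binary.Permutation.Propositional.Properties
  using (All-resp-↭; ↭-length; map⁺; ++⁺; ++⁺ˡ; ++⁺ʳ; shift; shifts; drop-∷)
open import Data.List.Relation.Binary.Permutation.Setoid.Properties using (foldr-commMonoid; onIndices-lookup)
open import Data.List.Relation.Unary.All as All using (All; []; _∷_)
open import Data.List.Relation.Unary.All.Properties using (¬All⇒Any¬; ¬Any⇒All¬)
open import Data.List.Relation.Unary.Any using (Any) renaming (any? to List-any?)
open import Data.Nat as ℕ using (ℕ; zero; suc; z≤n; s≤s; NonZero; _>_; _/_) renaming (_+_ to _ℕ+_)
open import Data.Nat.Coprimality using (prime⇒coprime; coprime-Bézout)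
import Data.Nat.Divisibility as ℕ
open import Data.Nat.DivMod using (m*n/n≡m)
open import Data.Nat.GCD using (module Bézout)
open import Data.Nat.ListAction using (product)
open import Data.Nat.Primality using (Prime; prime⇒nonZero; prime⇒nonTrivial; productOfPrimes≥1)
open import Data.Nat.Primality.Factorisation using (PrimeFactorisation; factorise)
import Data.Nat.Properties as ℕ
open import Data.Product using (_×_; _,_; proj₁; proj₂; ∃-syntax; Σ-syntax; ∃₂)
open import Data.Sum using (_⊎_; inj₁; inj₂; [_,_]′)
open import Function using (_∘_)
open import Relation.Binary.Definitions using (DecidableEquality)
open import Relation.Binary.PropositionalEquality as ≡ using (_≡_; _≢_; cong; cong₂; subst)
open import Relation.Nullary using (Dec; yes; no; ¬_; does; contradiction)
open import Relation.Nullary.Decidable using (¬?; _⊎-dec_; decidable-stable)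

-- Lists of pairs and their flattenings

flat : ∀ {A : Set} → List (A × A) → List A
flat []             = []
flat ((x , y) ∷ ps) = x ∷ y ∷ flat ps

flat-++ : ∀ {A : Set} (ps qs : List (A × A)) → flat (ps ++ qs) ≡ flat ps ++ flat qs
flat-++ []       qs = ≡.refl
flat-++ (p ∷ ps) qs = cong (λ l → _ ∷ _ ∷ l) (flat-++ ps qs)

flat-↭ : ∀ {A : Set} {ps qs : List (A × A)} → ps ↭ qs → flat ps ↭ flat qs
flat-↭ refl         = refl
flat-↭ (prep x r)   = prep _ (prep _ (flat-↭ r))
flat-↭ (swap (a , b) (c , d) r) =
  trans (shifts (a ∷ b ∷ []) (c ∷ d ∷ [])) (++⁺ˡ (c ∷ d ∷ a ∷ b ∷ []) (flat-↭ r))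
flat-↭ (trans r s)  = trans (flat-↭ r) (flat-↭ s)

length-flat : ∀ {A : Set} (ps : List (A × A)) → length (flat ps) ≡ length ps ℕ.* 2
length-flat []       = ≡.refl
length-flat (p ∷ ps) = cong (2 ℕ.+_) (length-flat ps)

flat-↭-length : ∀ {A : Set} {ps qs : List (A × A)} → flat ps ↭ flat qs → length ps ≡ length qs
flat-↭-length {ps = ps} {qs} r = ℕ.*-cancelʳ-≡ (length ps) (length qs) 2
  (≡.trans (≡.sym (length-flat ps)) (≡.trans (↭-length r) (length-flat qs)))

unflat : ∀ {A : Set} m (xs : List A) → length xs ≡ m ℕ.* 2 → ∃[ ps ] flat ps ≡ xs × length ps ≡ m
unflat zero    []           e = [] , ≡.refl , ≡.refl
unflat (suc m) (x ∷ y ∷ xs) e with unflat m xs (cong (ℕ._∸ 2) e)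
... | ps , ≡.refl , n = (x , y) ∷ ps , ≡.refl , cong suc n

∈⇒↭ : ∀ {A : Set} {x : A} {xs} → x Membership.∈ xs → ∃[ ys ] xs ↭ x ∷ ys
∈⇒↭ x∈xs with ∈-∃++ x∈xs
... | ls , rs , ≡.refl = ls ++ rs , shift _ ls rs

-- Pairing elements by a key, and parities of key counts

module Keyed {A B : Set} (_≟_ : DecidableEquality B) (f : A → B) where

  Unequal : A × A → Set
  Unequal (x , y) = f x ≢ f y

  Leads : B → A × A → Set
  Leads v (x , _) = f x ≡ v

  orient : ∀ v (qs : List (A × A)) → All (λ q → f (proj₁ q) ≡ v ⊎ f (proj₂ q) ≡ v) qs →
           ∃[ ps ] flat ps ↭ flat qs × All (Leads v) ps
  orient v []             []       = [] , refl , []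
  orient v ((x , y) ∷ qs) (h ∷ hs) with h | orient v qs hs
  ... | inj₁ e | ps , r , a = (x , y) ∷ ps , prep x (prep y r) , e ∷ a
  ... | inj₂ e | ps , r , a = (y , x) ∷ ps , swap y x r , e ∷ a

  -- In the second alternative at least half of all entries share the key `v`. The two alternatives
  -- correspond to the two ways of attaining residues modulo a prime: exchanging and sliding.
  Paired : List (A × A) → Set
  Paired qs = All Unequal qs ⊎ ∃[ v ] All (Leads v) qs

  -- If `x` and `y` share the key v, a pair `(c , d)` that avoids v can be broken up with them into
  -- the unequal pairs `(x , c)` and `(y , d)`. If no pair avoids v, every pair can be turned so
  -- that v leads.
  pairing-∷ : ∀ x y qs → All Unequal qs → ∃[ ps ] flat ps ↭ x ∷ y ∷ flat qs × Paired ps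
  pairing-∷ x y qs u with f x ≟ f y
  ... | no  x≢y = (x , y) ∷ qs , refl , inj₁ (x≢y ∷ u)
  ... | yes x≡y with All.all? (λ q → (f (proj₁ q) ≟ f x) ⊎-dec (f (proj₂ q) ≟ f x)) qs
  ...   | yes allv with orient (f x) qs allv
  ...     | ps , r , a = (x , y) ∷ ps , prep x (prep y r) , inj₂ (f x , ≡.refl ∷ a)
  pairing-∷ x y qs u | yes x≡y | no ¬allv
      with find (¬All⇒Any¬ (λ q → (f (proj₁ q) ≟ f x) ⊎-dec (f (proj₂ q) ≟ f x)) qs ¬allv)
  ... | (c , d) , q∈qs , c,d≢v with ∈⇒↭ q∈qs
  ... | rs , qs↭ with All-resp-↭ qs↭ u
  ... | _ ∷ u′ =
    (x , c) ∷ (y , d) ∷ rs ,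
    trans (prep x (swap c y refl)) (prep x (prep y (flat-↭ (↭-sym qs↭)))) ,
    inj₁ ((λ e → c,d≢v (inj₁ (≡.sym e))) ∷ (λ e → c,d≢v (inj₂ (≡.sym (≡.trans x≡y e)))) ∷ u′)

  -- Induction on the pairs. The delicate case is a new pair avoiding the leading key `v`: a pair
  -- with both entries of key `v` can share them out as `(c , x)` and `(d , y)`, both led by `v`; if
  -- there is none, all the old pairs are unequal and `pairing-∷` applies.
  pairing : ∀ qs → ∃[ ps ] flat ps ↭ flat qs × Paired ps
  pairing [] = [] , refl , inj₁ []
  pairing ((x , y) ∷ qs) with pairing qs
  ... | ps , r , inj₁ u with pairing-∷ x y ps u
  ...   | ps′ , r′ , t = ps′ , trans r′ (prep x (prep y r)) , t
  pairing ((x , y) ∷ qs) | ps , r , inj₂ (v , a) with (f x ≟ v) ⊎-dec (f y ≟ v)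
  ... | yes h with orient v ((x , y) ∷ ps) (h ∷ All.map inj₁ a)
  ...   | ps′ , r′ , a′ = ps′ , trans r′ (prep x (prep y r)) , inj₂ (v , a′)
  pairing ((x , y) ∷ qs) | ps , r , inj₂ (v , a) | no x,y≢v with List-any? (λ q → f (proj₂ q) ≟ v) ps
  ... | no ¬second with pairing-∷ x y ps
                          (All.zipWith (λ (e , d≢v) e′ → d≢v (≡.trans (≡.sym e′) e)) (a , ¬Any⇒All¬ ps ¬second))
  ...   | ps′ , r′ , t = ps′ , trans r′ (prep x (prep y r)) , t
  pairing ((x , y) ∷ qs) | ps , r , inj₂ (v , a) | no x,y≢v | yes second with find second
  ... | (c , d) , q∈ps , d≡v with ∈⇒↭ q∈ps
  ... | rs , ps↭ with All-resp-↭ ps↭ a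
  ... | c≡v ∷ a′ =
    (c , x) ∷ (d , y) ∷ rs ,
    trans (swap c x (swap d y refl)) (trans (prep x (swap c y refl)) (prep x (prep y (trans (flat-↭ (↭-sym ps↭)) r)))) ,
    inj₂ (v , c≡v ∷ d≡v ∷ a′)

  -- An entry whose key differs from that of `x` is moved next to `x`, and the remaining entries,
  -- even in number, are paired afresh.
  all-equal-or-unequal : ∀ x y qs → All (λ z → f z ≡ f x) (x ∷ y ∷ flat qs) ⊎
                         ∃[ z ] ∃[ ps ] x ∷ y ∷ flat qs ↭ x ∷ z ∷ flat ps × f x ≢ f z
  all-equal-or-unequal x y qs with All.all? (λ z → f z ≟ f x) (y ∷ flat qs)
  ... | yes a = inj₁ (≡.refl ∷ a)
  ... | no ¬a with find (¬All⇒Any¬ (λ z → f z ≟ f x) _ ¬a)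
  ... | z , z∈ , z≢x with ∈⇒↭ z∈
  ... | zs , r with unflat (length qs) zs (≡.trans (≡.sym (cong (ℕ._∸ 1) (↭-length r))) (length-flat qs))
  ... | ps , ≡.refl , _ = inj₂ (z , ps , prep x r , z≢x ∘ ≡.sym)

  parity : B → List A → Bool
  parity v []       = false
  parity v (x ∷ xs) = does (f x ≟ v) xor parity v xs

  parity-↭ : ∀ {v xs ys} → xs ↭ ys → parity v xs ≡ parity v ys
  parity-↭ refl            = ≡.refl
  parity-↭ {v} (prep x r)  = cong (does (f x ≟ v) xor_) (parity-↭ {v} r)
  parity-↭ {v} {_ ∷ _ ∷ xs} {_ ∷ _ ∷ ys} (swap x y r) = begin
    a xor (b xor parity v xs)  ≡⟨ xor-assoc a b _ ⟨
    (a xor b) xor parity v xs  ≡⟨ cong₂ _xor_ (xor-comm a b) (parity-↭ {v} r) ⟩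
    (b xor a) xor parity v ys  ≡⟨ xor-assoc b a _ ⟩
    b xor (a xor parity v ys)  ∎
    where
    open ≡.≡-Reasoning
    a = does (f x ≟ v)
    b = does (f y ≟ v)
  parity-↭ {v} (trans r s) = ≡.trans (parity-↭ {v} r) (parity-↭ {v} s)

  -- A pair with equal keys contributes 0 or 2 to the count of `v`, so an odd count forces an
  -- unequal pair.
  odd⇒unequal : ∀ {v} qs → parity v (flat qs) ≡ true →
                ∃[ l ] ∃[ x ] ∃[ y ] ∃[ r ] qs ≡ l ++ (x , y) ∷ r × f x ≢ f y
  odd⇒unequal {v} ((x , y) ∷ qs) odd with f x ≟ f y
  ... | no  x≢y = [] , x , y , qs , ≡.refl , x≢y
  ... | yes x≡y with odd⇒unequal {v} qs (≡.trans (≡.sym same) odd)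
    where
    same : parity v (x ∷ y ∷ flat qs) ≡ parity v (flat qs)
    same rewrite x≡y = ≡.trans (≡.sym (xor-assoc (does (f y ≟ v)) _ _))
                               (cong (_xor parity v (flat qs)) (xor-same (does (f y ≟ v))))
  ... | l , x′ , y′ , r , ≡.refl , x′≢y′ = (x , y) ∷ l , x′ , y′ , r , ≡.refl , x′≢y′

  -- Of `x` and `y` only `x` counts towards the key `f x`, so the two parities are opposite.
  odd-choice : ∀ x y xs → f x ≢ f y → parity (f x) (x ∷ xs) ≡ true ⊎ parity (f x) (y ∷ xs) ≡ true
  odd-choice x y xs x≢y with f x ≟ f x | f y ≟ f x
  ... | no  x≢x | _       = contradiction ≡.refl x≢x
  ... | yes _   | yes y≡x = contradiction (≡.sym y≡x) x≢y
  ... | yes _   | no  _   with parity (f x) xs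
  ...   | true  = inj₂ ≡.refl
  ...   | false = inj₁ ≡.refl

-- Congruences and residues

infix 4 _≈_[mod_]

-- The quotient is a signed witness, so that matching on a congruence yields an equation for the
-- ring solver.
record _≈_[mod_] (x y : ℤ) (m : ℕ) : Set where
  constructor by
  field
    multiple : ℤ
    equation : x ≡ y + multiple * + m

module _ {m : ℕ} where

  mod-reflexive : ∀ {x y} → x ≡ y → x ≈ y [mod m ]
  mod-reflexive ≡.refl = by 0ℤ (lemma _ (+ m))
    where
    lemma : ∀ x m → x ≡ x + 0ℤ * m
    lemma = solve-∀

  mod-sym : ∀ {x y} → x ≈ y [mod m ] → y ≈ x [mod m ]
  mod-sym {_} {y} (by k ≡.refl) = by (- k) (lemma y k (+ m))
    where
    lemma : ∀ y k m → y ≡ (y + k * m) + (- k) * m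
    lemma = solve-∀

  mod-trans : ∀ {x y z} → x ≈ y [mod m ] → y ≈ z [mod m ] → x ≈ z [mod m ]
  mod-trans {z = z} (by k ≡.refl) (by l ≡.refl) = by (l + k) (lemma z k l (+ m))
    where
    lemma : ∀ z k l m → (z + l * m) + k * m ≡ z + (l + k) * m
    lemma = solve-∀

  mod-+ : ∀ {x x′ y y′} → x ≈ x′ [mod m ] → y ≈ y′ [mod m ] → x + y ≈ x′ + y′ [mod m ]
  mod-+ {x′ = x} {y′ = y} (by k ≡.refl) (by l ≡.refl) = by (k + l) (lemma x y k l (+ m))
    where
    lemma : ∀ x y k l m → (x + k * m) + (y + l * m) ≡ x + y + (k + l) * m
    lemma = solve-∀

  mod-*ˡ : ∀ c {x y} → x ≈ y [mod m ] → c * x ≈ c * y [mod m ]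
  mod-*ˡ c {y = y} (by k ≡.refl) = by (c * k) (lemma c y k (+ m))
    where
    lemma : ∀ c y k m → c * (y + k * m) ≡ c * y + (c * k) * m
    lemma = solve-∀

  mod-neg : ∀ {x y} → x ≈ y [mod m ] → - x ≈ - y [mod m ]
  mod-neg {y = y} (by k ≡.refl) = by (- k) (lemma y k (+ m))
    where
    lemma : ∀ y k m → - (y + k * m) ≡ - y + (- k) * m
    lemma = solve-∀

module _ {m : ℕ} .{{_ : NonZero m}} where

  %ℕ-mod : ∀ x → x ≈ + (x %ℕ m) [mod m ]
  %ℕ-mod x = by (x /ℕ m) (a≡a%ℕn+[a/ℕn]*n x m)

  private
    ≢+multiple : ∀ {a b} k → a ℕ.< m → + a ≢ + b + + suc k * + m
    ≢+multiple {a} {b} k a<m e = ℕ.<⇒≱ a<m (begin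
      m                    ≤⟨ ℕ.m≤m+n m (k ℕ.* m) ⟩
      suc k ℕ.* m          ≤⟨ ℕ.m≤n+m _ b ⟩
      b ℕ.+ suc k ℕ.* m    ≡⟨ +-injective (≡.trans (cong (λ z → + b + z) (pos-* (suc k) m)) (≡.sym e)) ⟩
      a                    ∎)
      where open ℕ.≤-Reasoning

  <-mod-≡ : ∀ {a b} → a ℕ.< m → b ℕ.< m → + a ≈ + b [mod m ] → a ≡ b
  <-mod-≡         a<m b<m (by (+ zero)   e) = +-injective (≡.trans e (+-identityʳ _))
  <-mod-≡         a<m b<m (by (+ suc k)  e) = contradiction e (≢+multiple k a<m)
  <-mod-≡ {a} {b} a<m b<m (by -[1+ k ] e) =
    contradiction (≡.trans (lemma (+ b) (+ suc k) (+ m)) (cong (λ z → z + + suc k * + m) (≡.sym e))) (≢+multiple k b<m)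
    where
    lemma : ∀ b k m → b ≡ (b + (- k) * m) + k * m
    lemma = solve-∀

  %ℕ-≡⇒mod : ∀ {x y} → x %ℕ m ≡ y %ℕ m → x ≈ y [mod m ]
  %ℕ-≡⇒mod {x} {y} e = mod-trans (%ℕ-mod x) (mod-trans (mod-reflexive (cong +_ e)) (mod-sym (%ℕ-mod y)))

  mod⇒%ℕ-≡ : ∀ {x y} → x ≈ y [mod m ] → x %ℕ m ≡ y %ℕ m
  mod⇒%ℕ-≡ {x} {y} c =
    <-mod-≡ (n%ℕd<d x m) (n%ℕd<d y m) (mod-trans (mod-sym (%ℕ-mod x)) (mod-trans c (%ℕ-mod y)))

  residue : ℤ → Fin m
  residue x = fromℕ< (n%ℕd<d x m)

  residue-mod : ∀ x → x ≈ + toℕ (residue x) [mod m ]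
  residue-mod x = mod-trans (%ℕ-mod x) (mod-reflexive (cong +_ (≡.sym (toℕ-fromℕ< _))))

  toℕ-mod-injective : ∀ {i j : Fin m} → + toℕ i ≈ + toℕ j [mod m ] → i ≡ j
  toℕ-mod-injective {i} {j} c = toℕ-injective (<-mod-≡ (toℕ<n i) (toℕ<n j) c)

infixl 5 _⟫_
_⟫_ : ∀ {m x y z} → x ≈ y [mod m ] → y ≈ z [mod m ] → x ≈ z [mod m ]
_⟫_ = mod-trans

-- Two ways of weighting a list of pairs

pairSum : ℤ → List (ℤ × ℤ) → ℤ
pairSum k []             = 0ℤ
pairSum k ((x , y) ∷ ps) = k * (x + y) + pairSum (1ℤ + k) ps

-- Here a pair straddles two consecutive weights, so exchanging its entries changes the sum by their
-- difference, whatever the weight. In `pairSum` the exchange would change nothing.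
staggeredSum : ℤ → List (ℤ × ℤ) → ℤ
staggeredSum k []             = 0ℤ
staggeredSum k ((x , y) ∷ ps) = k * x + (1ℤ + k) * y + staggeredSum (1ℤ + k) ps

-- Division modulo a prime

module PrimeModulus (p : ℕ) (pr : Prime p) where

  private
    instance
      p≢0 : NonZero p
      p≢0 = prime⇒nonZero pr

  open Keyed ℕ._≟_ (_%ℕ p) public

  inverse : ∀ {d} → d %ℕ p ≢ 0 → ∃[ u ] u * d ≈ 1ℤ [mod p ]
  inverse {d} d≢0 with d %ℕ p in eq | n%ℕd<d d p
  ... | zero  | _   = contradiction ≡.refl d≢0
  ... | suc n | n<p with coprime-Bézout (prime⇒coprime pr n<p)
  -- Bézout's identity here reads 1 + y (suc n) = x p, so the inverse is - y.
  ...   | Bézout.+- x y e = - (+ y) , mod-*ˡ (- (+ y)) d≡n ⟫ by (- (+ x)) (lemma (+ y) (+ x) (+ suc n) (+ p) e′)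
    where
    d≡n : d ≈ + suc n [mod p ]
    d≡n = %ℕ-mod d ⟫ mod-reflexive (cong +_ eq)
    e′ : 1ℤ + + y * + suc n ≡ + x * + p
    e′ = ≡.trans (cong (λ z → 1ℤ + z) (≡.sym (pos-* y (suc n)))) (≡.trans (cong +_ e) (pos-* x p))
    lemma : ∀ y x n p → 1ℤ + y * n ≡ x * p → (- y) * n ≡ 1ℤ + (- x) * p
    lemma y x n p e = ≡.trans (l₁ y n) (≡.trans (cong (λ z → 1ℤ + - z) e) (l₂ x p))
      where
      l₁ : ∀ y n → (- y) * n ≡ 1ℤ + - (1ℤ + y * n)
      l₁ = solve-∀
      l₂ : ∀ x p → 1ℤ + - (x * p) ≡ 1ℤ + (- x) * p
      l₂ = solve-∀
  ...   | Bézout.-+ x y e = + y , mod-*ˡ (+ y) d≡n ⟫ by (+ x) e′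
    where
    d≡n : d ≈ + suc n [mod p ]
    d≡n = %ℕ-mod d ⟫ mod-reflexive (cong +_ eq)
    e′ : + y * + suc n ≡ 1ℤ + + x * + p
    e′ = ≡.trans (≡.sym (pos-* y (suc n))) (≡.trans (cong +_ (≡.sym e)) (cong (λ z → 1ℤ + z) (pos-* x p)))

  -- The difference is invertible modulo `p`. The quotient is reduced to a natural number below `p`
  -- because it serves as a number of steps, which for sliding must not exceed the number of places
  -- available.
  divide : ∀ {x y} → x %ℕ p ≢ y %ℕ p → ∀ t → ∃[ j ] j ℕ.< p × + j * (x - y) ≈ t [mod p ]
  divide {x} {y} x≢y t with inverse {x - y} d≢0
    where
    lemma : ∀ x y → x ≡ (x - y) + y
    lemma = solve-∀
    lemma₂ : ∀ y → 0ℤ + y ≡ y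
    lemma₂ = solve-∀
    d≢0 : (x - y) %ℕ p ≢ 0
    d≢0 e = x≢y (mod⇒%ℕ-≡ (mod-reflexive (lemma x y)
              ⟫ mod-+ (%ℕ-mod (x - y) ⟫ mod-reflexive (cong +_ e)) (mod-reflexive ≡.refl)
              ⟫ mod-reflexive (lemma₂ y)))
  ... | u , ud≡1 = (t * u) %ℕ p , n%ℕd<d (t * u) p ,
    ( mod-reflexive (l₁ (+ ((t * u) %ℕ p)) (x - y))
    ⟫ mod-*ˡ (x - y) (mod-sym (%ℕ-mod (t * u)))
    ⟫ mod-reflexive (l₂ (x - y) t u)
    ⟫ mod-*ˡ t ud≡1
    ⟫ mod-reflexive (l₃ t))
    where
    l₁ : ∀ j d → j * d ≡ d * j
    l₁ = solve-∀
    l₂ : ∀ d t u → d * (t * u) ≡ t * (u * d)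
    l₂ = solve-∀
    l₃ : ∀ t → t * 1ℤ ≡ t
    l₃ = solve-∀

  translate : ℤ → Fin p → Fin p
  translate d i = residue (+ toℕ i + d)

  -- Walking from i ∈ S in steps of d reaches every residue, so it leaves S unless S is everything.
  exit : ∀ {S : Subset p} d j {i t} → i ∈ S → t ∉ S → + toℕ i + + j * d ≈ + toℕ t [mod p ] →
         ∃[ l ] l ∈ S × translate d l ∉ S
  exit {S} d zero {i} {t} i∈S t∉S e =
    contradiction (subst (_∈ S) (toℕ-mod-injective (mod-reflexive (lemma (+ toℕ i) d) ⟫ e)) i∈S) t∉S
    where
    lemma : ∀ i d → i ≡ i + 0ℤ * d
    lemma = solve-∀
  exit {S} d (suc j) {i} {t} i∈S t∉S e with translate d i ∈? S
  ... | no  ∉S = i , i∈S , ∉S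
  ... | yes ∈S = exit d j ∈S t∉S
    ( mod-+ (mod-sym (residue-mod (+ toℕ i + d))) (mod-reflexive ≡.refl)
    ⟫ mod-reflexive (lemma (+ toℕ i) (+ j) d)
    ⟫ e)
    where
    lemma : ∀ i j d → i + d + j * d ≡ i + (1ℤ + j) * d
    lemma = solve-∀

  -- Residues reachable by exchanging entries of unequal pairs

  -- `e` accumulates the contribution of the pairs preceding `qs`, taken in their original
  -- orientation, and `k` is the weight at which `qs` begins.
  record ReachableFrom (e k : ℤ) (qs : List (ℤ × ℤ)) (r : Fin p) : Set where
    constructor reached
    field
      arrangement   : List (ℤ × ℤ)
      arrangement-↭ : flat arrangement ↭ flat qs
      value         : e + staggeredSum k arrangement ≈ + toℕ r [mod p ]

  -- `members` need only consist of reachable residues, not be all of them. `size` is the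
  -- Cauchy-Davenport bound: more residues than pairs, until everything is reached.
  record ReachableSet (e k : ℤ) (qs : List (ℤ × ℤ)) : Set where
    constructor reachableSet
    field
      members  : Subset p
      nonempty : Nonempty members
      reach    : ∀ {r} → r ∈ members → ReachableFrom e k qs r
      size     : length qs ℕ.< ∣ members ∣ ⊎ members ≡ ⊤

  reachable-[] : ∀ e k → ReachableSet e k []
  reachable-[] e k = reachableSet ⁅ residue e ⁆ (residue e , x∈⁅x⁆ _)
    (λ r∈ → reached [] refl (mod-reflexive (+-identityʳ e) ⟫ residue-mod e ⟫ mod-reflexive (cong (λ r → + toℕ r) (≡.sym (x∈⁅y⁆⇒x≡y _ r∈)))))
    (inj₁ (ℕ.≤-reflexive (≡.sym (∣⁅x⁆∣≡1 (residue e)))))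

  module _ {e k x y : ℤ} {qs : List (ℤ × ℤ)} (x≢y : x %ℕ p ≢ y %ℕ p) where

    private
      unswapped : ∀ {r} → ReachableFrom (e + (k * x + (1ℤ + k) * y)) (1ℤ + k) qs r → ReachableFrom e k ((x , y) ∷ qs) r
      unswapped (reached ps ps↭ c) =
        reached ((x , y) ∷ ps) (prep x (prep y ps↭)) (mod-reflexive (lemma e (k * x + (1ℤ + k) * y) (staggeredSum (1ℤ + k) ps)) ⟫ c)
        where
        lemma : ∀ e a b → e + (a + b) ≡ (e + a) + b
        lemma = solve-∀

      -- Moving `x` from weight `k` to `1ℤ + k` and `y` the other way adds `x - y`.
      swapped : ∀ {r} → ReachableFrom (e + (k * x + (1ℤ + k) * y)) (1ℤ + k) qs r →
                ReachableFrom e k ((x , y) ∷ qs) (translate (x - y) r)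
      swapped {r} (reached ps ps↭ c) = reached ((y , x) ∷ ps) (swap y x ps↭)
        ( mod-reflexive (lemma e k x y (staggeredSum (1ℤ + k) ps))
        ⟫ mod-+ c (mod-reflexive {x = x - y} ≡.refl)
        ⟫ residue-mod (+ toℕ r + (x - y)))
        where
        lemma : ∀ e k x y b → e + (k * y + (1ℤ + k) * x + b) ≡ (e + (k * x + (1ℤ + k) * y) + b) + (x - y)
        lemma = solve-∀

    escape : ∀ S → Nonempty S → S ≡ ⊤ ⊎ ∃[ l ] l ∈ S × translate (x - y) l ∉ S
    escape S (s , s∈S) = go (any? (λ t → ¬? (t ∈? S)))
      where
      cancel : ∀ s t → s + (t - s) ≡ t
      cancel = solve-∀
      go : Dec (∃[ t ] t ∉ S) → S ≡ ⊤ ⊎ ∃[ l ] l ∈ S × translate (x - y) l ∉ S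
      go (no full)       = inj₁ (⊆-antisym ⊆⊤ λ {t} _ → decidable-stable (t ∈? S) λ t∉S → full (t , t∉S))
      go (yes (t , t∉S)) = let j , _ , jd = divide {x} {y} x≢y (+ toℕ t - + toℕ s) in
        inj₂ (exit {S} (x - y) j s∈S t∉S
          (mod-+ (mod-reflexive {x = + toℕ s} ≡.refl) jd ⟫ mod-reflexive (cancel (+ toℕ s) (+ toℕ t))))

    reachable-∷ : ReachableSet (e + (k * x + (1ℤ + k) * y)) (1ℤ + k) qs → ReachableSet e k ((x , y) ∷ qs)
    reachable-∷ (reachableSet S ne reach size) = go (escape S ne)
      where
      go : S ≡ ⊤ ⊎ ∃[ l ] l ∈ S × translate (x - y) l ∉ S → ReachableSet e k ((x , y) ∷ qs)
      go (inj₁ full) = reachableSet S ne (λ r∈ → unswapped (reach r∈)) (inj₂ full)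
      -- Adding a single escaping residue, rather than the whole translate of `S`, already gives the
      -- growth by one that `size` demands.
      go (inj₂ (l , l∈S , l′∉S)) = reachableSet (⁅ l′ ⁆ ∪ S) (l′ , x∈p∪q⁺ (inj₁ (x∈⁅x⁆ l′)))
        (λ r∈ → [ (λ r∈l′ → subst (ReachableFrom e k ((x , y) ∷ qs)) (≡.sym (x∈⁅y⁆⇒x≡y l′ r∈l′)) (swapped (reach l∈S)))
                , (λ r∈S → unswapped (reach r∈S)) ]′ (x∈p∪q⁻ ⁅ l′ ⁆ S r∈))
        (grow size)
        where
        l′ = translate (x - y) l
        larger : ∣ S ∣ ℕ.< ∣ ⁅ l′ ⁆ ∪ S ∣
        larger = p⊂q⇒∣p∣<∣q∣ (q⊆p∪q ⁅ l′ ⁆ S , l′ , x∈p∪q⁺ (inj₁ (x∈⁅x⁆ l′)) , l′∉S)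
        grow : length qs ℕ.< ∣ S ∣ ⊎ S ≡ ⊤ → suc (length qs) ℕ.< ∣ ⁅ l′ ⁆ ∪ S ∣ ⊎ (⁅ l′ ⁆ ∪ S ≡ ⊤)
        grow (inj₁ h)    = inj₁ (ℕ.≤-<-trans h larger)
        grow (inj₂ full) = contradiction (subst (l′ ∈_) (≡.sym full) ∈⊤) l′∉S

  -- Cauchy–Davenport for sums of two-element sets: each unequal pair enlarges the set of reachable residues.
  reachable : ∀ {qs} → All Unequal qs → ∀ e k → ReachableSet e k qs
  reachable {[]}           []        e k = reachable-[] e k
  reachable {(x , y) ∷ qs} (x≢y ∷ u) e k = reachable-∷ x≢y (reachable u (e + (k * x + (1ℤ + k) * y)) (1ℤ + k))

  -- From staggered weights to common weights by rotation

  lastSecond : ℤ → List (ℤ × ℤ) → ℤ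
  lastSecond d []             = d
  lastSecond d ((_ , y) ∷ qs) = lastSecond y qs

  -- Every second entry moves on to the following pair. Its staggered weight is exactly the common
  -- weight of that pair, so nothing changes except at the two ends: `d` enters and the last second
  -- entry drops out.
  chain : ℤ → List (ℤ × ℤ) → List (ℤ × ℤ)
  chain d []             = []
  chain d ((x , y) ∷ qs) = (x , d) ∷ chain y qs

  chain-↭ : ∀ d qs → lastSecond d qs ∷ flat (chain d qs) ↭ d ∷ flat qs
  chain-↭ d []             = refl
  chain-↭ d ((x , y) ∷ qs) =
    trans (shifts [ lastSecond y qs ] (x ∷ d ∷ [])) (trans (swap x d (chain-↭ y qs)) refl)

  chain-sum : ∀ d k qs → pairSum k (chain d qs) + (k + + length qs) * lastSecond d qs ≡ k * d + staggeredSum k qs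
  chain-sum d k []             = lemma k d
    where
    lemma : ∀ k d → 0ℤ + (k + 0ℤ) * d ≡ k * d + 0ℤ
    lemma = solve-∀
  chain-sum d k ((x , y) ∷ qs) = ≡.trans (l₁ k x d _ (+ length qs) (lastSecond y qs))
    (≡.trans (cong (λ z → k * (x + d) + z) (chain-sum y (1ℤ + k) qs)) (l₂ k x d y _))
    where
    l₁ : ∀ k x d s n l → k * (x + d) + s + (k + (1ℤ + n)) * l ≡ k * (x + d) + (s + (1ℤ + k + n) * l)
    l₁ = solve-∀
    l₂ : ∀ k x d y s → k * (x + d) + ((1ℤ + k) * y + s) ≡ k * d + (k * x + (1ℤ + k) * y + s)
    l₂ = solve-∀

  -- Closing the chain into a cycle sends the last second entry from weight `p` to weight 0, which
  -- is harmless modulo `p`.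
  rotate-sum : ∀ qs → length qs ≡ p → ∃[ ps ] flat ps ↭ flat qs × pairSum 0ℤ ps ≈ staggeredSum 0ℤ qs [mod p ]
  rotate-sum []                e = [] , refl , mod-reflexive ≡.refl
  rotate-sum qs@((x , y) ∷ qs′) ≡.refl =
    chain d qs , drop-∷ (chain-↭ d qs) , by (- d) (lemma (pairSum 0ℤ (chain d qs)) d (staggeredSum 0ℤ qs) (+ length qs) (chain-sum d 0ℤ qs))
    where
    d = lastSecond y qs′
    l₁ : ∀ s d n → s ≡ (s + (0ℤ + n) * d) + (- d) * n
    l₁ = solve-∀
    lemma : ∀ s d t n → s + (0ℤ + n) * d ≡ 0ℤ * d + t → s ≡ t + (- d) * n
    lemma s d t n e = ≡.trans (l₁ s d n) (cong (λ z → z + (- d) * n) (≡.trans e (l₂ d t)))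
      where
      l₂ : ∀ d t → 0ℤ * d + t ≡ t
      l₂ = solve-∀

  -- Sliding one integer through copies of another

  slide : ℕ → ℤ → ℤ → List (ℤ × ℤ) → List (ℤ × ℤ)
  slide (suc w) x y ((x′ , y′) ∷ qs) = (x′ , y) ∷ slide w x y′ qs
  -- This clause is also reached when the list runs out; the bound `w ≤ length qs` in `slide-sum`
  -- guarantees that `x` moves all `w` places.
  slide _       x y qs               = (x , y) ∷ qs

  slide-↭ : ∀ w x y qs → flat (slide w x y qs) ↭ x ∷ y ∷ flat qs
  slide-↭ zero    x y qs               = refl
  slide-↭ (suc w) x y []               = refl
  slide-↭ (suc w) x y ((x′ , y′) ∷ qs) =
    trans (prep x′ (prep y (slide-↭ w x y′ qs)))
          (trans (shifts (x′ ∷ y ∷ []) (x ∷ [])) (prep x (swap x′ y refl)))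

  -- Each step raises the weight of `x` by one and lowers by one that of a leading entry congruent
  -- to `v`, which adds `x - v`.
  slide-sum : ∀ w k x y {v} qs → w ℕ.≤ length qs → All (Leads (v %ℕ p)) qs →
              pairSum k (slide w x y qs) ≈ pairSum k ((x , y) ∷ qs) + + w * (x - v) [mod p ]
  slide-sum zero k x y {v} qs z≤n a = mod-reflexive (lemma _ (x - v))
    where
    lemma : ∀ s d → s ≡ s + 0ℤ * d
    lemma = solve-∀
  slide-sum (suc w) k x y {v} ((x′ , y′) ∷ qs) (s≤s w≤) (x′≡v ∷ a) =
      mod-+ (mod-reflexive {x = k * (x′ + y)} ≡.refl) (slide-sum w (1ℤ + k) x y′ qs w≤ a)
    ⟫ mod-reflexive (l₁ k x x′ y y′ v (+ w) _)
    ⟫ mod-+ (mod-reflexive {x = pairSum k ((x , y) ∷ (x′ , y′) ∷ qs) + + w * (x - v)} ≡.refl)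
            (mod-+ (mod-reflexive {x = x} ≡.refl) (mod-neg (%ℕ-≡⇒mod {x = x′} {y = v} x′≡v)))
    ⟫ mod-reflexive (l₂ (pairSum k ((x , y) ∷ (x′ , y′) ∷ qs)) (+ w) (x - v))
    where
    l₁ : ∀ k x x′ y y′ v w s → k * (x′ + y) + ((1ℤ + k) * (x + y′) + s + w * (x - v)) ≡
                               k * (x + y) + ((1ℤ + k) * (x′ + y′) + s) + w * (x - v) + (x - x′)
    l₁ = solve-∀
    l₂ : ∀ s w d → s + w * d + d ≡ s + (1ℤ + w) * d
    l₂ = solve-∀

  -- Every residue is attained modulo a prime

  module _ {x y : ℤ} {qs : List (ℤ × ℤ)} (len : suc (length qs) ≡ p) (t : ℤ) where

    private
      Attained : Set
      Attained = ∃[ ps ] flat ps ↭ x ∷ y ∷ flat qs × pairSum 0ℤ ps ≈ t [mod p ]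

      length≡p : ∀ {ps} → flat ps ↭ x ∷ y ∷ flat qs → length ps ≡ p
      length≡p ps↭ = ≡.trans (flat-↭-length ps↭) len

    attained-unequal : ∀ {ps} → flat ps ↭ x ∷ y ∷ flat qs → All Unequal ps → Attained
    attained-unequal {ps} ps↭ u = go (reach (full size))
      where
      open ReachableSet (reachable u 0ℤ 0ℤ)
      full : length ps ℕ.< ∣ members ∣ ⊎ members ≡ ⊤ → residue t ∈ members
      full (inj₂ e) = subst (residue t ∈_) (≡.sym e) ∈⊤
      -- With `p` pairs the size bound would give more than `p` residues modulo `p`, so only the
      -- full set remains.
      full (inj₁ h) = contradiction (ℕ.≤-trans h (∣p∣≤n members)) (ℕ.<-irrefl (length≡p ps↭))
      lemma : ∀ s → s ≡ 0ℤ + s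
      lemma = solve-∀
      go : ReachableFrom 0ℤ 0ℤ ps (residue t) → Attained
      go (reached rs rs↭ c) = let zs , zs↭ , c′ = rotate-sum rs (length≡p (trans rs↭ ps↭)) in
        zs , trans zs↭ (trans rs↭ ps↭) , (c′ ⟫ mod-reflexive (lemma (staggeredSum 0ℤ rs)) ⟫ c ⟫ mod-sym (residue-mod t))

    -- With `d` turned to the front of its pair, w slides add w (d - c) to the sum, and w is found
    -- by division modulo `p`.
    attained-leading : ∀ {c d qs′} → flat ((c , d) ∷ qs′) ↭ x ∷ y ∷ flat qs →
                       All (Leads (c %ℕ p)) qs′ → d %ℕ p ≢ c %ℕ p → Attained
    attained-leading {c} {d} {rs} rs↭ a d≢c = go (divide {d} {c} d≢c (t - s))
      where
      s = pairSum 0ℤ ((d , c) ∷ rs)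
      lemma : ∀ s t → s + (t - s) ≡ t
      lemma = solve-∀
      go : (∃[ w ] w ℕ.< p × + w * (d - c) ≈ t - s [mod p ]) → Attained
      go (w , w<p , e) = slide w d c rs , trans (slide-↭ w d c rs) (trans (swap d c refl) rs↭) ,
        ( slide-sum w 0ℤ d c {c} rs (ℕ.s≤s⁻¹ (subst (w ℕ.<_) (≡.sym (length≡p rs↭)) w<p)) a
        ⟫ mod-+ (mod-reflexive {x = s} ≡.refl) e
        ⟫ mod-reflexive (lemma s t))

    constant : ∀ {v ps} → All (Leads v) ps → All (λ q → ¬ (proj₂ q %ℕ p ≢ v)) ps → All (λ z → z %ℕ p ≡ v) (flat ps)
    constant []       []       = []
    constant (e ∷ es) (d ∷ ds) = e ∷ decidable-stable (_ ℕ.≟ _) d ∷ constant es ds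

    -- Unequal pairs are settled by exchanging. If instead some v leads all pairs, a second entry
    -- different from v can be slid; were there none, all entries would be congruent, against `x≢y`.
    prime-target : x %ℕ p ≢ y %ℕ p → Attained
    prime-target x≢y = go (pairing ((x , y) ∷ qs))
      where
      leading : ∀ {v ps} → flat ps ↭ x ∷ y ∷ flat qs → All (Leads v) ps → Dec (Any (λ q → proj₂ q %ℕ p ≢ v) ps) → Attained
      leading {v} {ps} ps↭ a (no none) = contradiction (≡.trans (All.head all) (≡.sym (All.head (All.tail all)))) x≢y
        where
        all : All (λ z → z %ℕ p ≡ v) (x ∷ y ∷ flat qs)
        all = All-resp-↭ ps↭ (constant a (¬Any⇒All¬ ps none))
      leading {v} {ps} ps↭ a (yes some) =
        let (c , d) , q∈ , d≢v = find some
            rs , rs↭           = ∈⇒↭ q∈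
            a′                 = All-resp-↭ rs↭ a
            c≡v                = All.head a′
        in attained-leading (trans (flat-↭ (↭-sym rs↭)) ps↭)
             (All.map (λ h → ≡.trans h (≡.sym c≡v)) (All.tail a′)) (λ e → d≢v (≡.trans e c≡v))

      go : (∃[ ps ] flat ps ↭ x ∷ y ∷ flat qs × Paired ps) → Attained
      go (ps , ps↭ , inj₁ u)       = attained-unequal ps↭ u
      go (ps , ps↭ , inj₂ (v , a)) = leading ps↭ a (List-any? (λ q → ¬? (proj₂ q %ℕ p ℕ.≟ v)) ps)

-- Pair sums under shifts and concatenation

Pairs : Set
Pairs = List (ℤ × ℤ)

sum : List ℤ → ℤ
sum = foldr _+_ 0ℤ

sum-↭ : ∀ {xs ys} → xs ↭ ys → sum xs ≡ sum ys
sum-↭ r = foldr-commMonoid (≡.setoid ℤ) +-0-isCommutativeMonoid (↭⇒↭ₛ r)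

pairSum-shift : ∀ k c ps → pairSum (k + c) ps ≡ pairSum k ps + c * sum (flat ps)
pairSum-shift k c []             = lemma c
  where
  lemma : ∀ c → 0ℤ ≡ 0ℤ + c * 0ℤ
  lemma = solve-∀
pairSum-shift k c ((x , y) ∷ ps) = begin
  (k + c) * (x + y) + pairSum (1ℤ + (k + c)) ps
    ≡⟨ cong (λ w → (k + c) * (x + y) + pairSum w ps) (≡.sym (+-assoc 1ℤ k c)) ⟩
  (k + c) * (x + y) + pairSum (1ℤ + k + c) ps
    ≡⟨ cong (λ s → (k + c) * (x + y) + s) (pairSum-shift (1ℤ + k) c ps) ⟩
  (k + c) * (x + y) + (pairSum (1ℤ + k) ps + c * sum (flat ps))
    ≡⟨ lemma k c x y (pairSum (1ℤ + k) ps) (sum (flat ps)) ⟩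
  k * (x + y) + pairSum (1ℤ + k) ps + c * (x + (y + sum (flat ps))) ∎
  where
  open ≡.≡-Reasoning
  lemma : ∀ k c x y s t → (k + c) * (x + y) + (s + c * t) ≡ k * (x + y) + s + c * (x + (y + t))
  lemma = solve-∀

pairSum-++ : ∀ k ps qs → pairSum k (ps ++ qs) ≡ pairSum k ps + pairSum (k + + length ps) qs
pairSum-++ k []             qs =
  ≡.trans (cong (λ w → pairSum w qs) (≡.sym (+-identityʳ k))) (≡.sym (+-identityˡ (pairSum (k + 0ℤ) qs)))
pairSum-++ k ((x , y) ∷ ps) qs = begin
  k * (x + y) + pairSum (1ℤ + k) (ps ++ qs)
    ≡⟨ cong (λ s → k * (x + y) + s) (pairSum-++ (1ℤ + k) ps qs) ⟩
  k * (x + y) + (pairSum (1ℤ + k) ps + pairSum (1ℤ + k + + length ps) qs)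
    ≡⟨ +-assoc (k * (x + y)) (pairSum (1ℤ + k) ps) (pairSum (1ℤ + k + + length ps) qs) ⟨
  k * (x + y) + pairSum (1ℤ + k) ps + pairSum (1ℤ + k + + length ps) qs
    ≡⟨ cong (λ w → k * (x + y) + pairSum (1ℤ + k) ps + pairSum w qs) (lemma k (+ length ps)) ⟩
  k * (x + y) + pairSum (1ℤ + k) ps + pairSum (k + (1ℤ + + length ps)) qs ∎
  where
  open ≡.≡-Reasoning
  lemma : ∀ k n → 1ℤ + k + n ≡ k + (1ℤ + n)
  lemma = solve-∀

-- Balanced arrangements and their division into rows

record Balanced (m : ℕ) (qs : Pairs) : Set where
  constructor balanced
  field
    arrangement   : Pairs
    arrangement-↭ : flat arrangement ↭ flat qs
    sum≡0         : pairSum 0ℤ arrangement ≈ 0ℤ [mod m ]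

  arrangement-length : length arrangement ≡ length qs
  arrangement-length = flat-↭-length arrangement-↭

Balanced-resp-↭ : ∀ {m qs rs} → flat qs ↭ flat rs → Balanced m qs → Balanced m rs
Balanced-resp-↭ qs↭rs (balanced ps ps↭ c) = balanced ps (trans ps↭ qs↭rs) c

-- The given pairing carries no information, since an arrangement may re-pair `flat qs` freely; a
-- list of m pairs merely encodes 2m integers.
Balanceable : ℕ → Set
Balanceable m = ∀ qs → length qs ≡ m → Balanced m qs

split : ∀ {A : Set} n (xs : List A) {k} → length xs ≡ n ℕ.+ k →
        ∃₂ λ ys zs → xs ≡ ys ++ zs × length ys ≡ n × length zs ≡ k
split zero    xs       e = [] , xs , ≡.refl , ≡.refl , e
split (suc n) (x ∷ xs) e =
  let ys , zs , xs≡ , ys≡ , zs≡ = split n xs (ℕ.suc-injective e)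
  in x ∷ ys , zs , cong (x ∷_) xs≡ , cong suc ys≡ , zs≡

Row : ℕ → Pairs → Set
Row q ps = length ps ≡ q × pairSum 0ℤ ps ≈ 0ℤ [mod q ]

record Rows (q r : ℕ) (qs : Pairs) : Set where
  constructor rows
  field
    rowList : List Pairs
    count   : length rowList ≡ r
    valid   : All (Row q) rowList
    rows-↭  : flat (concat rowList) ↭ flat qs

row-∷ : ∀ {q r gs qs} → length gs ≡ q → Balanced q gs → Rows q r qs → Rows q (suc r) (gs ++ qs)
row-∷ {gs = gs} {qs} len (balanced ps ps↭ c) (rows pss n v pss↭) =
  rows (ps ∷ pss) (cong suc n) ((≡.trans (flat-↭-length ps↭) len , c) ∷ v)
    (trans (↭-reflexive (flat-++ ps (concat pss)))
      (trans (++⁺ ps↭ pss↭) (↭-reflexive (≡.sym (flat-++ gs qs)))))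

toRows : ∀ {q} → Balanceable q → ∀ r qs → length qs ≡ r ℕ.* q → Rows q r qs
toRows         B zero    []  e = rows [] ≡.refl [] refl
toRows {q = q} B (suc r) qs e =
  let gs , hs , qs≡ , gs≡ , hs≡ = split q qs e
  in subst (Rows q (suc r)) (≡.sym qs≡) (row-∷ gs≡ (B gs gs≡) (toRows B r hs hs≡))

-- Each row is balanced for weights from 0. Placing it at weights from i q adds i q times its total,
-- again a multiple of `q`.
rows-sum : ∀ {q} i {pss} → All (Row q) pss → pairSum (i * + q) (concat pss) ≈ 0ℤ [mod q ]
rows-sum         i []             = mod-reflexive ≡.refl
rows-sum {q = q} i {ps ∷ pss} ((≡.refl , c) ∷ v) =
    mod-reflexive (pairSum-++ (i * + q) ps (concat pss))
  ⟫ mod-+ (mod-reflexive (cong (λ w → pairSum w ps) (≡.sym (+-identityˡ (i * + q))))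
           ⟫ mod-reflexive (pairSum-shift 0ℤ (i * + q) ps)
           ⟫ mod-+ c (by {y = 0ℤ} (i * sum (flat ps)) (l₁ i (+ q) (sum (flat ps)))))
          (mod-reflexive (cong (λ w → pairSum w (concat pss)) (l₂ i (+ q))) ⟫ rows-sum (1ℤ + i) v)
  where
  l₁ : ∀ i q s → i * q * s ≡ 0ℤ + i * s * q
  l₁ = solve-∀
  l₂ : ∀ i q → i * q + q ≡ (1ℤ + i) * q
  l₂ = solve-∀

-- Affine substitution in the entries

affine : ℤ → ℕ → ℤ → ℤ
affine c p a = c + a * + p

mapPairs : (ℤ → ℤ) → Pairs → Pairs
mapPairs f = map (λ (x , y) → f x , f y)

flat-mapPairs : ∀ f ps → flat (mapPairs f ps) ≡ map f (flat ps)
flat-mapPairs f []       = ≡.refl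
flat-mapPairs f (_ ∷ ps) = cong (λ l → _ ∷ _ ∷ l) (flat-mapPairs f ps)

-- The factor `n * (k + k + n - 1ℤ)` is twice the sum of the weights k, ..., k + n - 1, each of
-- which occurs on two entries. The doubling makes it divisible by n when k = 0.
pairSum-affine : ∀ c p k ps → let n = + length ps in
  pairSum k (mapPairs (affine c p) ps) ≡ c * (n * (k + k + n - 1ℤ)) + + p * pairSum k ps
pairSum-affine c p k []             = lemma c k (+ p)
  where
  lemma : ∀ c k p → 0ℤ ≡ c * (0ℤ * (k + k + 0ℤ - 1ℤ)) + p * 0ℤ
  lemma = solve-∀
pairSum-affine c p k ((x , y) ∷ ps) = ≡.trans
  (cong (λ s → k * (affine c p x + affine c p y) + s) (pairSum-affine c p (1ℤ + k) ps))
  (lemma c (+ p) k x y (+ length ps) (pairSum (1ℤ + k) ps))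
  where
  lemma : ∀ c p k x y n s →
          k * ((c + x * p) + (c + y * p)) + (c * (n * (1ℤ + k + (1ℤ + k) + n - 1ℤ)) + p * s) ≡
          c * ((1ℤ + n) * (k + k + (1ℤ + n) - 1ℤ)) + p * (k * (x + y) + s)
  lemma = solve-∀

-- Columns through the rows

-- A context holds the parts of a row before and after its column entry, so the column can vary
-- while everything else stays in place.
assemble : List (Pairs × Pairs) → Pairs → Pairs
assemble ((l , r) ∷ ctxs) (c ∷ cs) = l ++ c ∷ r ++ assemble ctxs cs
assemble _                _        = []

assemble-↭-column : ∀ ctxs cs → length cs ≡ length ctxs →
                    assemble ctxs cs ↭ cs ++ concat (map (λ (l , r) → l ++ r) ctxs)
assemble-↭-column []               []       e = refl
assemble-↭-column ((l , r) ∷ ctxs) (c ∷ cs) e = begin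
  l ++ c ∷ r ++ assemble ctxs cs           ↭⟨ shift c l (r ++ assemble ctxs cs) ⟩
  c ∷ l ++ r ++ assemble ctxs cs           ≡⟨ cong (c ∷_) (++-assoc l r (assemble ctxs cs)) ⟨
  c ∷ (l ++ r) ++ assemble ctxs cs         ↭⟨ prep c (++⁺ˡ (l ++ r) (assemble-↭-column ctxs cs (ℕ.suc-injective e))) ⟩
  c ∷ (l ++ r) ++ (cs ++ _)                ↭⟨ prep c (shifts (l ++ r) cs) ⟩
  c ∷ cs ++ (l ++ r) ++ _                  ∎
  where open PermutationReasoning

assemble-↭ : ∀ ctxs {cs cs′} → length cs ≡ length ctxs → flat cs′ ↭ flat cs →
             flat (assemble ctxs cs′) ↭ flat (assemble ctxs cs)
assemble-↭ ctxs {cs} {cs′} e cs′↭cs =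
  trans (flat-↭ (assemble-↭-column ctxs cs′ (≡.trans (flat-↭-length cs′↭cs) e)))
  (trans (↭-reflexive (flat-++ cs′ _))
  (trans (++⁺ʳ _ cs′↭cs)
  (trans (↭-reflexive (≡.sym (flat-++ cs _)))
         (flat-↭ (↭-sym (assemble-↭-column ctxs cs e))))))

Shape : ℕ → ℕ → Pairs × Pairs → Set
Shape q j (l , r) = length l ≡ j × j ℕ.+ suc (length r) ≡ q

-- In row i the column entry has weight i q + j.
assemble-sum : ∀ {q j ctxs} i → All (Shape q j) ctxs →
  ∃[ E ] ∀ cs → length cs ≡ length ctxs →
  pairSum (i * + q) (assemble ctxs cs) ≡ + q * pairSum i cs + + j * sum (flat cs) + E
assemble-sum {q} {j} i [] = 0ℤ , λ { [] _ → lemma (+ q) (+ j) }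
  where
  lemma : ∀ q j → 0ℤ ≡ q * 0ℤ + j * 0ℤ + 0ℤ
  lemma = solve-∀
assemble-sum {q} {j} {(l , r) ∷ ctxs} i ((≡.refl , ≡.refl) ∷ shape) =
  let E , eq = assemble-sum (1ℤ + i) shape in
  pairSum k l + pairSum (1ℤ + (k + + j)) r + E ,
  λ { ((x , y) ∷ cs) e → begin
    pairSum k (l ++ (x , y) ∷ r ++ assemble ctxs cs)
      ≡⟨ pairSum-++ k l ((x , y) ∷ r ++ assemble ctxs cs) ⟩
    pairSum k l + ((k + + j) * (x + y) + pairSum (1ℤ + (k + + j)) (r ++ assemble ctxs cs))
      ≡⟨ cong (λ s → pairSum k l + ((k + + j) * (x + y) + s)) (pairSum-++ (1ℤ + (k + + j)) r (assemble ctxs cs)) ⟩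
    pairSum k l + ((k + + j) * (x + y) +
      (pairSum (1ℤ + (k + + j)) r + pairSum (1ℤ + (k + + j) + + length r) (assemble ctxs cs)))
      ≡⟨ cong (λ s → pairSum k l + ((k + + j) * (x + y) + (pairSum (1ℤ + (k + + j)) r + s)))
          (≡.trans (cong (λ w → pairSum w (assemble ctxs cs)) next) (eq cs (ℕ.suc-injective e))) ⟩
    pairSum k l + ((k + + j) * (x + y) +
      (pairSum (1ℤ + (k + + j)) r + (+ q * pairSum (1ℤ + i) cs + + j * sum (flat cs) + E)))
      ≡⟨ l₂ (pairSum k l) i (+ q) (+ j) x y (pairSum (1ℤ + (k + + j)) r) (pairSum (1ℤ + i) cs) (sum (flat cs)) E ⟩
    + q * (i * (x + y) + pairSum (1ℤ + i) cs) + + j * (x + (y + sum (flat cs))) +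
      (pairSum k l + pairSum (1ℤ + (k + + j)) r + E) ∎ }
  where
  open ≡.≡-Reasoning
  k = i * + q
  l₁ : ∀ i q j r → q ≡ j + (1ℤ + r) → 1ℤ + (i * q + j) + r ≡ (1ℤ + i) * q
  l₁ i q j r ≡.refl = lemma i j r
    where
    lemma : ∀ i j r → 1ℤ + (i * (j + (1ℤ + r)) + j) + r ≡ (1ℤ + i) * (j + (1ℤ + r))
    lemma = solve-∀
  next : 1ℤ + (k + + j) + + length r ≡ (1ℤ + i) * + q
  next = l₁ i (+ q) (+ j) (+ length r) (pos-+ j (suc (length r)))
  l₂ : ∀ L i q j x y R P S E → L + ((i * q + j) * (x + y) + (R + (q * P + j * S + E))) ≡
                               q * (i * (x + y) + P) + j * (x + (y + S)) + (L + R + E)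
  l₂ = solve-∀

record Column (q j : ℕ) (pss : List Pairs) : Set where
  constructor column
  field
    contexts  : List (Pairs × Pairs)
    entries   : Pairs
    shape     : All (Shape q j) contexts
    lengths   : length entries ≡ length contexts
    count     : length entries ≡ length pss
    assembles : concat pss ≡ assemble contexts entries

column-∷ : ∀ {q j pss} l c r → Shape q j (l , r) → Column q j pss → Column q j ((l ++ c ∷ r) ∷ pss)
column-∷ {pss = pss} l c r sh (column ctxs cs shs len n eq) =
  column ((l , r) ∷ ctxs) (c ∷ cs) (sh ∷ shs) (cong suc len) (cong suc n)
    (≡.trans (++-assoc l (c ∷ r) (concat pss)) (cong (λ z → l ++ c ∷ r ++ z) eq))

extract : ∀ {q j k pss} → j ℕ.+ suc k ≡ q → All (Row q) pss → Column q j pss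
extract         e []                             = column [] [] [] ≡.refl ≡.refl ≡.refl
extract {q} {j} {k} {ps ∷ pss} e ((len , _) ∷ v) = go (split j ps (≡.trans len (≡.sym e)))
  where
  go : (∃₂ λ l r → ps ≡ l ++ r × length l ≡ j × length r ≡ suc k) → Column q j (ps ∷ pss)
  go (l , c ∷ r , ≡.refl , l≡ , ≡.refl) = column-∷ l c r (l≡ , e) (extract e v)

-- The induction step from q to p q

module PrimeStep (p : ℕ) (pr : Prime p) where

  open PrimeModulus p pr

  private
    instance
      p≢0 : NonZero p
      p≢0 = prime⇒nonZero pr

  -- Writing each entry as x + p a, the sum becomes x n (n - 1) + p P with n = p q and P the sum for
  -- the quotients a. Balancing `p` rows of quotients makes P a multiple of `q`, hence p P one of p
  -- q.
  prime-constant : ∀ {q} x y qs → Balanceable q → suc (length qs) ≡ p ℕ.* q →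
                   All (λ z → z %ℕ p ≡ x %ℕ p) (x ∷ y ∷ flat qs) → Balanced (p ℕ.* q) ((x , y) ∷ qs)
  prime-constant {q} x y qs B len all = go (quotients ((x , y) ∷ qs) all)
    where
    quotients : ∀ ps → All (λ z → z %ℕ p ≡ x %ℕ p) (flat ps) → ∃[ ps′ ] ps ≡ mapPairs (affine x p) ps′
    quotients []             []        = [] , ≡.refl
    quotients ((a , b) ∷ ps) (ea ∷ eb ∷ es) =
      let by k a≡ = %ℕ-≡⇒mod {p} {a} {x} ea
          by l b≡ = %ℕ-≡⇒mod {p} {b} {x} eb
          ps′ , eq = quotients ps es
      in (k , l) ∷ ps′ , cong₂ _∷_ (cong₂ _,_ a≡ b≡) eq

    go : (∃[ ps′ ] (x , y) ∷ qs ≡ mapPairs (affine x p) ps′) → Balanced (p ℕ.* q) ((x , y) ∷ qs)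
    go (ps′ , eq) = build (toRows B p ps′ len′)
      where
      len′ : length ps′ ≡ p ℕ.* q
      len′ = ≡.trans (≡.sym (length-map _ ps′)) (≡.trans (cong length (≡.sym eq)) len)
      build : Rows q p ps′ → Balanced (p ℕ.* q) ((x , y) ∷ qs)
      build (rows pss _ v pss↭) = balanced (mapPairs (affine x p) zs) perm (sum≡ (rows-sum 0ℤ v))
        where
        zs = concat pss
        perm : flat (mapPairs (affine x p) zs) ↭ x ∷ y ∷ flat qs
        perm = trans (↭-reflexive (flat-mapPairs _ zs)) (trans (map⁺ _ pss↭)
                 (↭-reflexive (≡.trans (≡.sym (flat-mapPairs _ ps′)) (cong flat (≡.sym eq)))))
        zs-length : length zs ≡ p ℕ.* q
        zs-length = ≡.trans (flat-↭-length pss↭) len′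
        lemma : ∀ x n p q s k → n ≡ p * q → s ≡ 0ℤ + k * q →
                x * (n * (0ℤ + 0ℤ + n - 1ℤ)) + p * s ≡ 0ℤ + (x * (p * q - 1ℤ) + k) * (p * q)
        lemma x n p q s k ≡.refl ≡.refl = identity x p q k
          where
          identity : ∀ x p q k → x * (p * q * (0ℤ + 0ℤ + p * q - 1ℤ)) + p * (0ℤ + k * q) ≡
                                 0ℤ + (x * (p * q - 1ℤ) + k) * (p * q)
          identity = solve-∀
        sum≡ : pairSum 0ℤ zs ≈ 0ℤ [mod q ] → pairSum 0ℤ (mapPairs (affine x p) zs) ≈ 0ℤ [mod p ℕ.* q ]
        sum≡ (by k e) = by (x * (+ p * + q - 1ℤ) + k) (≡.trans (pairSum-affine x p 0ℤ zs)
          (≡.trans (lemma x (+ length zs) (+ p) (+ q) (pairSum 0ℤ zs) k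
                     (≡.trans (cong +_ zs-length) (pos-* p q)) e)
                   (cong (λ n → 0ℤ + (x * (+ p * + q - 1ℤ) + k) * n) (≡.sym (pos-* p q)))))

  -- Rearranging within column j, whose weights are ≡ j modulo q, moves the sum by any multiple of q.
  repair-column : ∀ {q j pss x y cs} (C : Column q j pss) → Column.entries C ≡ (x , y) ∷ cs →
                  x %ℕ p ≢ y %ℕ p → length pss ≡ p → All (Row q) pss → Balanced (p ℕ.* q) (concat pss)
  repair-column {q} {j} {pss} {x} {y} {cs} (column ctxs _ sh len n eq) ≡.refl x≢y pss-length v =
    go (subst (λ zs → pairSum 0ℤ zs ≈ 0ℤ [mod q ]) eq (rows-sum 0ℤ v)) (assemble-sum 0ℤ sh)
    where
    es = (x , y) ∷ cs
    lemma : ∀ p q j P₀ P S E s k → q * P₀ + j * S + E ≡ 0ℤ + s * q → P ≡ (P₀ - s) + k * p →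
            q * P + j * S + E ≡ 0ℤ + k * (p * q)
    lemma p q j P₀ P S E s k e ≡.refl = ≡.trans (l₁ p q j P₀ S E s k)
      (≡.trans (cong (λ z → z + (k * p - s) * q) e) (l₂ p q s k))
      where
      l₁ : ∀ p q j P₀ S E s k → q * ((P₀ - s) + k * p) + j * S + E ≡ (q * P₀ + j * S + E) + (k * p - s) * q
      l₁ = solve-∀
      l₂ : ∀ p q s k → (0ℤ + s * q) + (k * p - s) * q ≡ 0ℤ + k * (p * q)
      l₂ = solve-∀
    go : pairSum 0ℤ (assemble ctxs es) ≈ 0ℤ [mod q ] →
         (∃[ E ] ∀ cs → length cs ≡ length ctxs →
            pairSum 0ℤ (assemble ctxs cs) ≡ + q * pairSum 0ℤ cs + + j * sum (flat cs) + E) →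
         Balanced (p ℕ.* q) (concat pss)
    -- The present sum is s q. Lowering the column's own sum by s modulo `p` lowers the total by s q
    -- modulo p q, because column sums enter with the factor q.
    go (by s e) (E , formula) = build (prime-target (≡.trans n pss-length) (pairSum 0ℤ es - s) x≢y)
      where
      build : (∃[ zs ] flat zs ↭ flat es × pairSum 0ℤ zs ≈ pairSum 0ℤ es - s [mod p ]) → Balanced (p ℕ.* q) (concat pss)
      build (zs , zs↭ , by k e′) = balanced (assemble ctxs zs)
        (trans (assemble-↭ ctxs len zs↭) (↭-reflexive (cong flat (≡.sym eq))))
        (by k (≡.trans (formula zs (≡.trans (flat-↭-length zs↭) len))
          (≡.trans (cong (λ S → + q * pairSum 0ℤ zs + + j * S + E) (sum-↭ zs↭))
          (≡.trans (lemma (+ p) (+ q) (+ j) (pairSum 0ℤ es) (pairSum 0ℤ zs) (sum (flat es)) E s k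
                     (≡.trans (≡.sym (formula es len)) e) e′)
                   (cong (λ n → 0ℤ + k * n) (≡.sym (pos-* p q)))))))

  -- The arrangement of the first row is not under control, but its entries are: parity survives any
  -- rearrangement, so an unequal pair is present wherever the balancing puts it. Its position fixes
  -- the column to repair.
  odd-row : ∀ {q r v gs qs} → Balanceable q → suc r ≡ p → length gs ≡ q → length qs ≡ r ℕ.* q →
            parity v (flat gs) ≡ true → Balanced (p ℕ.* q) (gs ++ qs)
  odd-row {q} {r} {v} {gs} {qs} B suc-r≡p gs≡ qs≡ odd = build (B gs gs≡) (toRows B r qs qs≡)
    where
    build : Balanced q gs → Rows q r qs → Balanced (p ℕ.* q) (gs ++ qs)
    build (balanced ps ps↭ c) (rows pss n val pss↭) = go (odd⇒unequal {v} ps (≡.trans (parity-↭ {v} ps↭) odd))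
      where
      ps-length : length ps ≡ q
      ps-length = ≡.trans (flat-↭-length ps↭) gs≡
      go : (∃[ l ] ∃[ x ] ∃[ y ] ∃[ r ] ps ≡ l ++ (x , y) ∷ r × x %ℕ p ≢ y %ℕ p) → Balanced (p ℕ.* q) (gs ++ qs)
      go (l , x , y , r , ≡.refl , x≢y) = Balanced-resp-↭
        (trans (↭-reflexive (flat-++ ps (concat pss))) (trans (++⁺ ps↭ pss↭) (↭-reflexive (≡.sym (flat-++ gs qs)))))
        (repair-column (column-∷ l (x , y) r (≡.refl , sh) (extract sh val)) ≡.refl
          x≢y (≡.trans (cong suc n) suc-r≡p) ((ps-length , c) ∷ val))
        where
        sh : length l ℕ.+ suc (length r) ≡ q
        sh = ≡.trans (≡.sym (length-++ l)) ps-length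

  -- Choosing which of x and y goes into the first row makes some residue occur an odd number of times there.
  prime-nonconstant : ∀ {q x y qs} → Balanceable (suc q) → suc (length qs) ≡ p ℕ.* suc q →
                      x %ℕ p ≢ y %ℕ p → Balanced (p ℕ.* suc q) ((x , y) ∷ qs)
  prime-nonconstant {q} {x} {y} {qs} B len x≢y = go p ≡.refl (ℕ.nonTrivial⇒n>1 p {{prime⇒nonTrivial pr}})
    where
    go : ∀ p′ → p′ ≡ p → 1 ℕ.< p′ → Balanced (p ℕ.* suc q) ((x , y) ∷ qs)
    go (suc zero)    _ (s≤s ())
    go (suc (suc r)) e _ = build (split q qs qs-length)
      where
      qs-length : length qs ≡ q ℕ.+ suc (q ℕ.+ r ℕ.* suc q)
      qs-length = ℕ.suc-injective (≡.trans len (cong (ℕ._* suc q) (≡.sym e)))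
      build : (∃₂ λ gs hs → qs ≡ gs ++ hs × length gs ≡ q × length hs ≡ suc (q ℕ.+ r ℕ.* suc q)) →
              Balanced (p ℕ.* suc q) ((x , y) ∷ qs)
      -- Since p > 1 there is a second row, and its first pair `(u , w)` is broken up: `u` joins
      -- whichever of `x` and `y` enters the first row, and `w` joins the other.
      build (gs , (u , w) ∷ hs , ≡.refl , gs≡ , hs≡) =
        [ (λ odd → Balanced-resp-↭ (exchange x y (prep x (swap u y refl)))
                     (odd-row B e (cong suc gs≡) hs≡ odd))
        , (λ odd → Balanced-resp-↭ (exchange y x (trans (prep y (swap u x refl)) (swap y x refl)))
                     (odd-row B e (cong suc gs≡) hs≡ odd)) ]′
        (odd-choice x y (u ∷ flat gs) x≢y)
        where
        exchange : ∀ a b → a ∷ u ∷ b ∷ w ∷ flat (gs ++ hs) ↭ x ∷ y ∷ u ∷ w ∷ flat (gs ++ hs) →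
                   flat ((a , u) ∷ gs ++ (b , w) ∷ hs) ↭ flat ((x , y) ∷ gs ++ (u , w) ∷ hs)
        exchange a b r =
          trans (flat-↭ (prep (a , u) (shift (b , w) gs hs)))
          (trans r (flat-↭ (prep (x , y) (↭-sym (shift (u , w) gs hs)))))

  prime-step : ∀ {q} → Balanceable (suc q) → Balanceable (p ℕ.* suc q)
  prime-step B []             len = balanced [] refl (mod-reflexive ≡.refl)
  prime-step {q} B ((x , y) ∷ qs) len = [ prime-constant x y qs B len , unequal ]′ (all-equal-or-unequal x y qs)
    where
    unequal : (∃[ z ] ∃[ ps ] x ∷ y ∷ flat qs ↭ x ∷ z ∷ flat ps × x %ℕ p ≢ z %ℕ p) →
              Balanced (p ℕ.* suc q) ((x , y) ∷ qs)
    unequal (z , ps , r , x≢z) = Balanced-resp-↭ (↭-sym r)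
      (prime-nonconstant B (≡.trans (flat-↭-length {ps = (x , z) ∷ ps} {(x , y) ∷ qs} (↭-sym r)) len) x≢z)

-- Induction over the prime factorisation

balanceable-product : ∀ {ps} → All Prime ps → Balanceable (product ps)
balanceable-product []                  qs  len = balanced qs refl (by (pairSum 0ℤ qs) (lemma (pairSum 0ℤ qs)))
  where
  lemma : ∀ s → s ≡ 0ℤ + s * 1ℤ
  lemma = solve-∀
balanceable-product {p ∷ ps} (pr ∷ prs) = go (product ps) (productOfPrimes≥1 prs) (balanceable-product prs)
  where
  go : ∀ q → 1 ℕ.≤ q → Balanceable q → Balanceable (p ℕ.* q)
  go (suc q) _ = PrimeStep.prime-step p pr

balanceable : ∀ m → .{{NonZero m}} → Balanceable m
balanceable m = subst Balanceable (≡.sym isFactorisation) (balanceable-product factorsPrime)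
  where open PrimeFactorisation (factorise m)

-- From arrangements of lists to permutations of indices

progressionSum : ℤ → ℤ → List ℤ → ℤ
progressionSum u v []       = 0ℤ
progressionSum u v (x ∷ xs) = u * x + progressionSum (u + v) v xs

∑-tabulate : ∀ {n} (a : Fin n → ℤ) → sum (tabulate a) ≡ ∑ a
∑-tabulate {zero}  a = ≡.refl
∑-tabulate {suc n} a = cong (λ s → a zero + s) (∑-tabulate (λ i → a (suc i)))

∑-progression : ∀ {n} u v xs (e : n ≡ length xs) (w f : Fin n → ℤ) → (∀ i → w i ≡ u + + toℕ i * v) →
                (∀ i → lookup xs (cast e i) ≡ f i) → ∑ (λ i → w i * f i) ≡ progressionSum u v xs
∑-progression {zero}  u v []       e w f w≡ f≡ = ≡.refl
∑-progression {suc n} u v (x ∷ xs) e w f w≡ f≡ = cong₂ _+_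
  (cong₂ _*_ (≡.trans (w≡ zero) (l₁ u v)) (≡.sym (f≡ zero)))
  (∑-progression (u + v) v xs (ℕ.suc-injective e) (λ i → w (suc i)) (λ i → f (suc i))
    (λ i → ≡.trans (w≡ (suc i)) (l₂ u (+ toℕ i) v)) (λ i → f≡ (suc i)))
  where
  l₁ : ∀ u v → u + 0ℤ * v ≡ u
  l₁ = solve-∀
  l₂ : ∀ u i v → u + (1ℤ + i) * v ≡ u + v + i * v
  l₂ = solve-∀

-- The permutation is read off from the list permutation alone, before any weights are given, so one
-- σ serves all progressions.
permutation : ∀ {n} (a : Fin n → ℤ) xs → xs ↭ tabulate a →
              Σ[ σ ∈ Permutation′ n ] ∀ u v (w : Fin n → ℤ) → (∀ i → w i ≡ u + + toℕ i * v) →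
              ∑ (λ i → w i * a (σ ⟨$⟩ʳ i)) ≡ progressionSum u v xs
permutation {n} a xs r =
  cast-id e ∘ₚ π ∘ₚ cast-id e′ ,
  λ u v w w≡ → ∑-progression u v xs e w (λ i → a (cast e′ (π ⟨$⟩ʳ cast e i))) w≡ λ i →
    ≡.trans (onIndices-lookup (≡.setoid ℤ) (↭⇒↭ₛ r) (cast e i))
      (≡.trans (cong (lookup (tabulate a)) (≡.sym (cast-involutive (≡.sym e′) e′ (π ⟨$⟩ʳ cast e i))))
               (lookup-tabulate a (cast e′ (π ⟨$⟩ʳ cast e i))))
  where
  π = onIndices (↭⇒↭ₛ r)
  e′ : length (tabulate a) ≡ n
  e′ = length-tabulate a
  e : n ≡ length xs
  e = ≡.sym (≡.trans (↭-length r) e′)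

-- With all first entries listed before all second entries, the two members of a pair stand m places
-- apart, for m pairs; their weights 1, ..., 2m then agree modulo m.
firsts seconds : Pairs → List ℤ
firsts  = map proj₁
seconds = map proj₂

unzipped-↭ : ∀ ps → firsts ps ++ seconds ps ↭ flat ps
unzipped-↭ []             = refl
unzipped-↭ ((x , y) ∷ ps) = prep x (trans (shift y (firsts ps) (seconds ps)) (prep y (unzipped-↭ ps)))

progressionSum-++ : ∀ u v xs ys → progressionSum u v (xs ++ ys) ≡
                    progressionSum u v xs + progressionSum (u + + length xs * v) v ys
progressionSum-++ u v []       ys = ≡.trans (cong (λ u → progressionSum u v ys) (l u v))
                                            (≡.sym (+-identityˡ (progressionSum (u + 0ℤ * v) v ys)))
  where
  l : ∀ u v → u ≡ u + 0ℤ * v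
  l = solve-∀
progressionSum-++ u v (x ∷ xs) ys = begin
  u * x + progressionSum (u + v) v (xs ++ ys)
    ≡⟨ cong (λ s → u * x + s) (progressionSum-++ (u + v) v xs ys) ⟩
  u * x + (progressionSum (u + v) v xs + progressionSum (u + v + + length xs * v) v ys)
    ≡⟨ +-assoc (u * x) (progressionSum (u + v) v xs) (progressionSum (u + v + + length xs * v) v ys) ⟨
  u * x + progressionSum (u + v) v xs + progressionSum (u + v + + length xs * v) v ys
    ≡⟨ cong (λ u′ → u * x + progressionSum (u + v) v xs + progressionSum u′ v ys) (l u v (+ length xs)) ⟩
  u * x + progressionSum (u + v) v xs + progressionSum (u + (1ℤ + + length xs) * v) v ys ∎
  where
  open ≡.≡-Reasoning
  l : ∀ u v n → u + v + n * v ≡ u + (1ℤ + n) * v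
  l = solve-∀

-- `c` is the gap between the weights of the two members of a pair; `k` is general for the sake of
-- the induction.
unzipped-sum : ∀ u v c k ps →
  progressionSum (u + k * v) v (firsts ps) + progressionSum (u + k * v + c) v (seconds ps) ≡
  u * sum (flat ps) + v * pairSum k ps + c * sum (seconds ps)
unzipped-sum u v c k []             = l u v c
  where
  l : ∀ u v c → 0ℤ ≡ u * 0ℤ + v * 0ℤ + c * 0ℤ
  l = solve-∀
unzipped-sum u v c k ((x , y) ∷ ps) = begin
  t * x + progressionSum (t + v) v (firsts ps) + ((t + c) * y + progressionSum (t + c + v) v (seconds ps))
    ≡⟨ l₁ t c x y (progressionSum (t + v) v (firsts ps)) (progressionSum (t + c + v) v (seconds ps)) ⟩
  t * x + (t + c) * y + (progressionSum (t + v) v (firsts ps) + progressionSum (t + c + v) v (seconds ps))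
    ≡⟨ cong (λ s → t * x + (t + c) * y + s)
        (≡.trans (cong₂ (λ b d → progressionSum b v (firsts ps) + progressionSum d v (seconds ps)) (l₂ u k v) (l₃ u k v c))
                 (unzipped-sum u v c (1ℤ + k) ps)) ⟩
  t * x + (t + c) * y + (u * sum (flat ps) + v * pairSum (1ℤ + k) ps + c * sum (seconds ps))
    ≡⟨ l₄ u k v c x y (sum (flat ps)) (pairSum (1ℤ + k) ps) (sum (seconds ps)) ⟩
  u * (x + (y + sum (flat ps))) + v * (k * (x + y) + pairSum (1ℤ + k) ps) + c * (y + sum (seconds ps)) ∎
  where
  open ≡.≡-Reasoning
  t = u + k * v
  l₁ : ∀ t c x y f s → t * x + f + ((t + c) * y + s) ≡ t * x + (t + c) * y + (f + s)
  l₁ = solve-∀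
  l₂ : ∀ u k v → u + k * v + v ≡ u + (1ℤ + k) * v
  l₂ = solve-∀
  l₃ : ∀ u k v c → u + k * v + c + v ≡ u + (1ℤ + k) * v + c
  l₃ = solve-∀
  l₄ : ∀ u k v c x y F P S → (u + k * v) * x + (u + k * v + c) * y + (u * F + v * P + c * S) ≡
                             u * (x + (y + F)) + v * (k * (x + y) + P) + c * (y + S)
  l₄ = solve-∀

arrangement-sum : ∀ u v ps → progressionSum u v (firsts ps ++ seconds ps) ≡
                  u * sum (flat ps) + v * (pairSum 0ℤ ps + + length ps * sum (seconds ps))
arrangement-sum u v ps = begin
  progressionSum u v (firsts ps ++ seconds ps)
    ≡⟨ progressionSum-++ u v (firsts ps) (seconds ps) ⟩
  progressionSum u v (firsts ps) + progressionSum (u + + length (firsts ps) * v) v (seconds ps)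
    ≡⟨ cong₂ (λ b d → progressionSum b v (firsts ps) + progressionSum d v (seconds ps)) (l₁ u v)
        (≡.trans (cong (λ n → u + + n * v) (length-map proj₁ ps)) (l₂ u v (+ length ps))) ⟩
  progressionSum (u + 0ℤ * v) v (firsts ps) + progressionSum (u + 0ℤ * v + + length ps * v) v (seconds ps)
    ≡⟨ unzipped-sum u v (+ length ps * v) 0ℤ ps ⟩
  u * sum (flat ps) + v * pairSum 0ℤ ps + + length ps * v * sum (seconds ps)
    ≡⟨ l₃ u v (sum (flat ps)) (pairSum 0ℤ ps) (+ length ps) (sum (seconds ps)) ⟩
  u * sum (flat ps) + v * (pairSum 0ℤ ps + + length ps * sum (seconds ps)) ∎
  where
  open ≡.≡-Reasoning
  l₁ : ∀ u v → u ≡ u + 0ℤ * v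
  l₁ = solve-∀
  l₂ : ∀ u v n → u + n * v ≡ u + 0ℤ * v + n * v
  l₂ = solve-∀
  l₃ : ∀ u v F P n S → u * F + v * P + n * v * S ≡ u * F + v * (P + n * S)
  l₃ = solve-∀

-- An exact identity rather than a congruence, with σ and k independent of the progression: both
-- claims, with their different moduli, follow from it by specialisation.
progression-permutation : ∀ m .{{_ : NonZero m}} (a : Fin (m ℕ.* 2) → ℤ) →
  Σ[ σ ∈ Permutation′ (m ℕ.* 2) ] ∃[ k ] ∀ u v (w : Fin (m ℕ.* 2) → ℤ) → (∀ i → w i ≡ u + + toℕ i * v) →
  ∑ (λ i → w i * a (σ ⟨$⟩ʳ i)) ≡ u * ∑ a + v * (k * + m)
progression-permutation m a = go (unflat m (tabulate a) (length-tabulate a))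
  where
  go : (∃[ qs ] flat qs ≡ tabulate a × length qs ≡ m) → _
  go (qs , flat≡ , len) = build (balanceable m qs len)
    where
    build : Balanced m qs → _
    build B@(balanced ps ps↭ (by k e)) =
      let σ , σ-sum = permutation a (firsts ps ++ seconds ps)
                        (trans (unzipped-↭ ps) (trans ps↭ (↭-reflexive flat≡)))
      in σ , k + sum (seconds ps) , λ u v w w≡ → begin
        ∑ (λ i → w i * a (σ ⟨$⟩ʳ i))
          ≡⟨ σ-sum u v w w≡ ⟩
        progressionSum u v (firsts ps ++ seconds ps)
          ≡⟨ arrangement-sum u v ps ⟩
        u * sum (flat ps) + v * (pairSum 0ℤ ps + + length ps * sum (seconds ps))
          ≡⟨ cong₂ (λ s t → u * s + v * t) total
               (cong₂ (λ s n → s + + n * sum (seconds ps)) e (≡.trans (Balanced.arrangement-length B) len)) ⟩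
        u * ∑ a + v * (0ℤ + k * + m + + m * sum (seconds ps))
          ≡⟨ cong (λ s → u * ∑ a + v * s) (l k (+ m) (sum (seconds ps))) ⟩
        u * ∑ a + v * ((k + sum (seconds ps)) * + m) ∎
      where
      open ≡.≡-Reasoning
      l : ∀ k m s → 0ℤ + k * m + m * s ≡ (k + s) * m
      l = solve-∀
      total : sum (flat ps) ≡ ∑ a
      total = ≡.trans (sum-↭ ps↭) (≡.trans (cong sum flat≡) (∑-tabulate a))

-- Both claims for n = 2m

multiple⇒∣ : ∀ q {x n} → x ≡ q * n → n ∣ x
multiple⇒∣ q {x} {n} e = Signed.∣⇒∣ᵤ {n} {x} (Signed.divides q e)

theorem1p2 : (n : ℕ) → n > 0 → (+ 2) ∣ (+ n) → (a : Fin n → ℤ) → (+ n) ∣ ∑ a →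
    (Σ[ σ ∈ Permutation′ n ] ((+ (n / 2)) ∣ ∑ (λ i → (+ (toℕ i ℕ+ 1)) * a ((σ ⟨$⟩ʳ i) ))))
    × ((w : Fin n → ℤ) → (∃[ c ] ∃[ d ] ((+ 2) ∣ d × ((i : Fin n) → w i ≡ c + (+ toℕ i) * d)))
    → Σ[ σ ∈ Permutation′ n ] ((+ n) ∣ ∑ (λ i → w i * a (σ ⟨$⟩ʳ i))))
theorem1p2 _ _ (ℕ.divides m@(suc _) ≡.refl) a n∣∑a =
  -- The weights 1, ..., n are the progression with u = v = 1. The total s (2m) and the remainder k
  -- m are both multiples of m = n / 2.
  (σ , subst (λ h → + h ∣ ∑ (λ i → + (toℕ i ℕ+ 1) * a (σ ⟨$⟩ʳ i))) (≡.sym (m*n/n≡m m 2))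
    (multiple⇒∣ (s * + 2 + k)
      (≡.trans (σ-sum 1ℤ 1ℤ (λ i → + (toℕ i ℕ+ 1)) (λ i → ≡.trans (pos-+ (toℕ i) 1) (l₁ (+ toℕ i))))
        (≡.trans (cong (λ S → 1ℤ * S + 1ℤ * (k * + m)) ∑a≡) (l₂ s k (+ m)))))) ,
  -- The even difference d = 2e turns d k m into e k (2m), and the constant term c contributes c
  -- times the total, a multiple of n.
  λ w (c , d , 2∣d , w≡) →
    let Signed.divides e d≡ = Signed.∣ᵤ⇒∣ {+ 2} {d} 2∣d in
    σ , multiple⇒∣ (c * s + e * k)
      (≡.trans (σ-sum c d w w≡)
        (≡.trans (cong₂ (λ S d → c * S + d * (k * + m)) ∑a≡ d≡)
          (≡.trans (l₃ c s e k (+ m)) (cong (λ n → (c * s + e * k) * n) (≡.sym (pos-* m 2))))))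
  where
  σ,k = progression-permutation m a
  σ = proj₁ σ,k
  k = proj₁ (proj₂ σ,k)
  σ-sum = proj₂ (proj₂ σ,k)
  n∣ₛ∑a = Signed.∣ᵤ⇒∣ {+ (m ℕ.* 2)} {∑ a} n∣∑a
  s = Signed.quotient n∣ₛ∑a
  ∑a≡ : ∑ a ≡ s * (+ m * + 2)
  ∑a≡ = ≡.trans (Signed._∣_.equality n∣ₛ∑a) (cong (λ n → s * n) (pos-* m 2))
  l₁ : ∀ i → i + 1ℤ ≡ 1ℤ + i * 1ℤ
  l₁ = solve-∀
  l₂ : ∀ s k m → 1ℤ * (s * (m * + 2)) + 1ℤ * (k * m) ≡ (s * + 2 + k) * m
  l₂ = solve-∀
  l₃ : ∀ c s e k m → c * (s * (m * + 2)) + e * + 2 * (k * m) ≡ (c * s + e * k) * (m * + 2)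
  l₃ = solve-∀
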